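{- For strictly positive formulas $A,B$: (i) $A\vdash_{\mathbf{RJ}}B$ iff $\mathrm{RJ}_S[A]\Vdash B$, where $S=\ell(A)$; (ii) $A\vdash_{\mathbf{RC}}B$ iff $\mathrm{RC}_S[A]\Vdash B$, where $S=\ell(\{A,B\})$. Here $\Vdash$ means truth at the root.
   Context: Strictly positive formulas: $A::= p\mid \top\mid (A\land B)\mid \alpha A$, $\alpha\le\omega$; $\ell(X)$ is the set of modalities occurring in formulas of $X$. $\mathbf{RJ}$: $A\vdash A$; $A\vdash\top$; cut; $A\land B\vdash A$; $A\land B\vdash B$; from $A\vdash B$, $A\vdash C$ infer $A\vdash B\land C$; from $A\vdash B$ infer $\alpha A\vdash\alpha B$; $\alpha\alpha A\vdash\alpha A$; $\alpha\beta A\vdash\beta A$, $\beta\alpha A\vdash\beta A$ for $\alpha\ge\beta$; $\alpha A\land\beta B\vdash\alpha(A\land\beta B)$ for $\alpha>\beta$. $\mathbf{RC}=\mathbf{RJ}+\{\alpha A\vdash\beta A:\alpha>\beta\}$. Kripke models of signature $S$: $W$, relations $(R_\alpha)_{\alpha\in S}$, valuation, usual forcing with $x\Vdash\alpha A$ iff $\exists y(xR_\alpha y\wedge y\Vdash A)$. RJ$_S$-frame: $R_\alpha R_\beta\subseteq R_{\min(\alpha,\beta)}$ for $\alpha,\beta\in S$, and for $\alpha>\beta$ in $S$, $xR_\alpha y\wedge xR_\beta z\Rightarrow yR_\beta z$. RC$_S$-frame: RJ$_S$-frame with $R_\alpha\subseteq R_\beta$ for $\beta<\alpha$. The canonical tree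 $T[A]$: for a variable or $\top$, one node with empty relations where only that variable is true; $T[B\land C]$: disjoint union of $T[B],T[C]$ with roots identified, a variable true at the root iff true at either root; $T[\alpha B]$: $T[B]$ plus a new root $r$ (all variables false) with $rR_\alpha$(root of $T[B]$). For $S\supseteq\ell(A)$, $\mathrm{RJ}_S[A]$ (resp. $\mathrm{RC}_S[A]$) is the model on the same set and valuation as $T[A]$ whose relations are the least relations containing those of $T[A]$ (relations for $\alpha\in S\setminus\ell(A)$ starting empty) forming an RJ$_S$-frame (resp. RC$_S$-frame). -}

module Defs where

open import Data.Empty using (⊥)
open import Data.Maybe.Base using (Maybe; just; nothing; map)
open import Data.Nat.Base as ℕ using (ℕ)
import Data.Nat.Properties as ℕ
open import Data.Product.Base using (Σ; Σ-syntax; ∃; ∃-syntax; _×_; _,_)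
open import Data.Sum.Base using (_⊎_; inj₁; inj₂)
open import Data.Unit.Base using (⊤)
open import Level using (0ℓ)
open import Relation.Binary.Core using (Rel)
open import Relation.Binary.Construct.Never using (Never)
open import Relation.Binary.PropositionalEquality using (_≡_; refl; sym; cong; subst)
open import Relation.Nullary.Construct.Add.Supremum using (_⁺; [_]; ⊤⁺)
open import Relation.Unary using (Pred; _∈_; _⊆_; _∪_; ∅; ｛_｝)
import Relation.Binary.Construct.Add.Supremum.NonStrict as NonStrict
import Relation.Binary.Construct.Add.Supremum.Strict as Strict

-- The ordinals ≤ ω; ω is the added top element ⊤⁺.
Modality : Set
Modality = ℕ ⁺

open Strict ℕ._<_ public using () renaming (_<⁺_ to _<ᵐ_)
open NonStrict ℕ._≤_ public using () renaming (_≤⁺_ to _≤ᵐ_)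

infixl 7 _⊓_

_⊓_ : Modality → Modality → Modality
[ m ] ⊓ [ n ] = [ m ℕ.⊓ n ]
[ m ] ⊓ ⊤⁺    = [ m ]
⊤⁺    ⊓ β     = β

⊓-sel : ∀ α β → (α ⊓ β ≡ α) ⊎ (α ⊓ β ≡ β)
⊓-sel [ m ] [ n ] with ℕ.⊓-sel m n
... | inj₁ e = inj₁ (cong [_] e)
... | inj₂ e = inj₂ (cong [_] e)
⊓-sel [ m ] ⊤⁺ = inj₁ refl
⊓-sel ⊤⁺ β     = inj₂ refl

Signature : Set₁
Signature = Pred Modality 0ℓ

⊓-closed : ∀ (S : Signature) {α β} → α ∈ S → β ∈ S → (α ⊓ β) ∈ S
⊓-closed S {α} {β} a b with ⊓-sel α β
... | inj₁ e = subst S (sym e) a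
... | inj₂ e = subst S (sym e) b

Var : Set
Var = ℕ

infixr 6 _∧ᶠ_
infixr 7 ⟨_⟩_

data Formula : Set where
  var  : Var → Formula
  ⊤ᶠ   : Formula
  _∧ᶠ_ : Formula → Formula → Formula
  ⟨_⟩_ : Modality → Formula → Formula

modalities : Formula → Signature
modalities (var p)   = ∅
modalities ⊤ᶠ        = ∅
modalities (A ∧ᶠ B)  = modalities A ∪ modalities B
modalities (⟨ α ⟩ A) = ｛ α ｝ ∪ modalities A

ℓ : Pred Formula 0ℓ → Signature
ℓ X α = ∃[ A ] (A ∈ X × α ∈ modalities A)

ℓ-mono : ∀ (X Y : Pred Formula 0ℓ) → X ⊆ Y → ℓ X ⊆ ℓ Y
ℓ-mono X Y X⊆Y (A , A∈X , α∈A) = A , X⊆Y A∈X , α∈A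

-- Derivability in RJ extended by a set X of additional axioms (sequents).
data RJ+ (X : Rel Formula 0ℓ) : Rel Formula 0ℓ where
  axiom    : ∀ {A B} → X A B → RJ+ X A B
  identity : ∀ {A} → RJ+ X A A
  top      : ∀ {A} → RJ+ X A ⊤ᶠ
  cut      : ∀ {A B C} → RJ+ X A B → RJ+ X B C → RJ+ X A C
  ∧-elimˡ  : ∀ {A B} → RJ+ X (A ∧ᶠ B) A
  ∧-elimʳ  : ∀ {A B} → RJ+ X (A ∧ᶠ B) B
  ∧-intro  : ∀ {A B C} → RJ+ X A B → RJ+ X A C → RJ+ X A (B ∧ᶠ C)
  nec      : ∀ {α A B} → RJ+ X A B → RJ+ X (⟨ α ⟩ A) (⟨ α ⟩ B)
  trans    : ∀ {α A} → RJ+ X (⟨ α ⟩ ⟨ α ⟩ A) (⟨ α ⟩ A)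
  absorbˡ  : ∀ {α β A} → β ≤ᵐ α → RJ+ X (⟨ α ⟩ ⟨ β ⟩ A) (⟨ β ⟩ A)
  absorbʳ  : ∀ {α β A} → β ≤ᵐ α → RJ+ X (⟨ β ⟩ ⟨ α ⟩ A) (⟨ β ⟩ A)
  import∧  : ∀ {α β A B} → β <ᵐ α →
             RJ+ X (⟨ α ⟩ A ∧ᶠ ⟨ β ⟩ B) (⟨ α ⟩ (A ∧ᶠ ⟨ β ⟩ B))

data Monotonicity : Rel Formula 0ℓ where
  lower : ∀ {α β A} → β <ᵐ α → Monotonicity (⟨ α ⟩ A) (⟨ β ⟩ A)

infix 4 _⊢RJ_ _⊢RC_

_⊢RJ_ : Rel Formula 0ℓ
_⊢RJ_ = RJ+ Never

_⊢RC_ : Rel Formula 0ℓ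
_⊢RC_ = RJ+ Monotonicity

-- Families (R_α)_{α ∈ S}. The membership proof is irrelevant, so that there is
-- exactly one relation for each α ∈ S.
Relations : Signature → Set → Set₁
Relations S W = ∀ α → .(α ∈ S) → Rel W 0ℓ

record Model (S : Signature) : Set₁ where
  field
    W : Set
    R : Relations S W
    V : Var → Pred W 0ℓ

-- A formula ⟨ α ⟩ A with α ∉ S is false at every point of a model of
-- signature S: there is no relation R_α to provide a successor.
infix 4 _,_⊩_

_,_⊩_ : ∀ {S} (M : Model S) → Model.W M → Formula → Set
M , x ⊩ var p = Model.V M p x
M , x ⊩ ⊤ᶠ = ⊤
M , x ⊩ A ∧ᶠ B = (M , x ⊩ A) × (M , x ⊩ B)
_,_⊩_ {S} M x (⟨ α ⟩ A) =
  Σ[ s ∈ α ∈ S ] ∃[ y ] (Model.R M α s x y × (M , y ⊩ A))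

record IsRJFrame {S : Signature} {W : Set} (R : Relations S W) : Set where
  field
    comp : ∀ {α β x y z} (a : α ∈ S) (b : β ∈ S) →
           R α a x y → R β b y z → R (α ⊓ β) (⊓-closed S a b) x z
    eucl : ∀ {α β x y z} (a : α ∈ S) (b : β ∈ S) → β <ᵐ α →
           R α a x y → R β b x z → R β b y z

record IsRCFrame {S : Signature} {W : Set} (R : Relations S W) : Set where
  field
    isRJFrame : IsRJFrame R
    mono      : ∀ {α β x y} (a : α ∈ S) (b : β ∈ S) → β <ᵐ α →
                R α a x y → R β b x y
  open IsRJFrame isRJFrame public

-- The least RJ_S-frame (resp. RC_S-frame) relations containing R; see
-- RJ-isRJFrame, RJ-least, RC-isRCFrame and RC-least.
data RJClosure {S W} (R : Relations S W) : Modality → Rel W 0ℓ where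
  base : ∀ {α x y} (a : α ∈ S) → R α a x y → RJClosure R α x y
  comp : ∀ {α β x y z} →
         RJClosure R α x y → RJClosure R β y z → RJClosure R (α ⊓ β) x z
  eucl : ∀ {α β x y z} → β <ᵐ α →
         RJClosure R α x y → RJClosure R β x z → RJClosure R β y z

data RCClosure {S W} (R : Relations S W) : Modality → Rel W 0ℓ where
  base : ∀ {α x y} (a : α ∈ S) → R α a x y → RCClosure R α x y
  comp : ∀ {α β x y z} →
         RCClosure R α x y → RCClosure R β y z → RCClosure R (α ⊓ β) x z
  eucl : ∀ {α β x y z} → β <ᵐ α →
         RCClosure R α x y → RCClosure R β x z → RCClosure R β y z
  mono : ∀ {α β x y} → β ∈ S → β <ᵐ α →
         RCClosure R α x y → RCClosure R β x y

closeRJ closeRC : ∀ {S} → Model S → Model S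
closeRJ M = record { W = W ; R = λ α _ → RJClosure R α ; V = V } where open Model M
closeRC M = record { W = W ; R = λ α _ → RCClosure R α ; V = V } where open Model M

module _ {S : Signature} {W : Set} (R : Relations S W) where

  RJ-isRJFrame : IsRJFrame {S} (λ α _ → RJClosure R α)
  RJ-isRJFrame = record { comp = λ _ _ → comp ; eucl = λ _ _ → eucl }

  RC-isRCFrame : IsRCFrame {S} (λ α _ → RCClosure R α)
  RC-isRCFrame = record
    { isRJFrame = record { comp = λ _ _ → comp ; eucl = λ _ _ → eucl }
    ; mono      = λ _ b → mono b
    }

  RJ-support : ∀ {α x y} → RJClosure R α x y → α ∈ S
  RJ-support (base a _)   = a
  RJ-support (comp r q)   = ⊓-closed S (RJ-support r) (RJ-support q)
  RJ-support (eucl _ _ q) = RJ-support q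

  RC-support : ∀ {α x y} → RCClosure R α x y → α ∈ S
  RC-support (base a _)   = a
  RC-support (comp r q)   = ⊓-closed S (RC-support r) (RC-support q)
  RC-support (eucl _ _ q) = RC-support q
  RC-support (mono b _ _) = b

  module _ (Q : Relations S W) (R⊆Q : ∀ {α x y} (a : α ∈ S) → R α a x y → Q α a x y) where

    RJ-least : IsRJFrame Q → ∀ {α x y} (a : α ∈ S) → RJClosure R α x y → Q α a x y
    RJ-least F _ (base a r) = R⊆Q a r
    RJ-least F _ (comp r q) =
      IsRJFrame.comp F (RJ-support r) (RJ-support q)
        (RJ-least F (RJ-support r) r) (RJ-least F (RJ-support q) q)
    RJ-least F b (eucl β<α r q) =
      IsRJFrame.eucl F (RJ-support r) b β<α (RJ-least F (RJ-support r) r) (RJ-least F b q)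

    RC-least : IsRCFrame Q → ∀ {α x y} (a : α ∈ S) → RCClosure R α x y → Q α a x y
    RC-least F _ (base a r) = R⊆Q a r
    RC-least F _ (comp r q) =
      IsRCFrame.comp F (RC-support r) (RC-support q)
        (RC-least F (RC-support r) r) (RC-least F (RC-support q) q)
    RC-least F b (eucl β<α r q) =
      IsRCFrame.eucl F (RC-support r) b β<α (RC-least F (RC-support r) r) (RC-least F b q)
    RC-least F b (mono _ β<α r) =
      IsRCFrame.mono F (RC-support r) b β<α (RC-least F (RC-support r) r)

-- Enlarging the signature, with empty relations for the new modalities.
extend : ∀ {S} (S′ : Signature) → .(S ⊆ S′) → Model S → Model S′
extend {S} S′ _ M = record
  { W = W
  ; R = λ α _ x y → Σ[ s ∈ α ∈ S ] R α s x y
  ; V = V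
  } where open Model M

-- The nodes of T[A] are its root `nothing` and its non-root nodes `just x`;
-- identifying the roots of T[A] and T[B] leaves the disjoint union of the
-- non-root nodes, and `map inj₁`, `map inj₂` embed the two trees.
NonRoot : Formula → Set
NonRoot (var p)   = ⊥
NonRoot ⊤ᶠ        = ⊥
NonRoot (A ∧ᶠ B)  = NonRoot A ⊎ NonRoot B
NonRoot (⟨ α ⟩ A) = Maybe (NonRoot A)

Node : Formula → Set
Node A = Maybe (NonRoot A)

root : ∀ A → Node A
root A = nothing

data Edge : (A : Formula) → Modality → Rel (Node A) 0ℓ where
  left  : ∀ {A B α x y} → Edge A α x y → Edge (A ∧ᶠ B) α (map inj₁ x) (map inj₁ y)
  right : ∀ {A B α x y} → Edge B α x y → Edge (A ∧ᶠ B) α (map inj₂ x) (map inj₂ y)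
  new   : ∀ {α A} → Edge (⟨ α ⟩ A) α (root (⟨ α ⟩ A)) (just (root A))
  old   : ∀ {α β A x y} → Edge A β x y → Edge (⟨ α ⟩ A) β (just x) (just y)

Valuation : (A : Formula) → Var → Pred (Node A) 0ℓ
Valuation (var q)   p nothing         = p ≡ q
Valuation ⊤ᶠ        p nothing         = ⊥
Valuation (A ∧ᶠ B)  p nothing         = Valuation A p (root A) ⊎ Valuation B p (root B)
Valuation (A ∧ᶠ B)  p (just (inj₁ x)) = Valuation A p (just x)
Valuation (A ∧ᶠ B)  p (just (inj₂ x)) = Valuation B p (just x)
Valuation (⟨ α ⟩ A) p nothing         = ⊥
Valuation (⟨ α ⟩ A) p (just x)        = Valuation A p x

T[_] : (A : Formula) → Model (ℓ ｛ A ｝)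
T[ A ] = record { W = Node A ; R = λ α _ → Edge A α ; V = Valuation A }

RJ⟦_,_,_⟧ RC⟦_,_,_⟧ : (S : Signature) (A : Formula) → .(ℓ ｛ A ｝ ⊆ S) → Model S
RJ⟦ S , A , A⊆S ⟧ = closeRJ (extend S A⊆S T[ A ])
RC⟦ S , A , A⊆S ⟧ = closeRC (extend S A⊆S T[ A ])

{-# OPTIONS --safe #-}

-- Soundness is checked on frames, a formula with a modality outside the
-- signature being false everywhere.  For RC a derivation may pass through
-- modalities outside S, so an RC_S-frame is first expanded to all modalities
-- without changing R_α for α ∈ S.  Completeness: the filters of formulas form
-- a canonical frame, and T[A] maps homomorphically into it with the root going
-- to { D : A ⊢ D }.  The canonical relations pulled back along this map form
-- a frame containing T[A], hence contain the least one, so whatever is forced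
-- at a node belongs to its filter.
module Submission where

open import Defs
open import Data.Maybe.Base using (just; nothing; map)
open import Data.Nat.Base as ℕ using ()
import Data.Nat.Properties as ℕ
open import Data.Product.Base using (_×_; _,_; proj₁; proj₂)
open import Data.Sum.Base using (_⊎_; inj₁; inj₂)
open import Data.Unit.Base using (tt)
open import Function.Base using (id; _∘_)
open import Function.Bundles using (_⇔_; mk⇔)
open import Level using (0ℓ)
open import Relation.Binary.Construct.Add.Supremum.NonStrict ℕ._≤_ as NonStrict using (_≤⊤⁺)
open import Relation.Binary.Construct.Add.Supremum.Strict ℕ._<_ as Strict using ([_]<⊤⁺; <⁺-trans)
open import Relation.Binary.Construct.Never using (Never)
open import Relation.Binary.Core using (Rel)
open import Relation.Binary.PropositionalEquality using (_≡_; refl; sym; cong; subst₂)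
open import Relation.Nullary.Construct.Add.Supremum using ([_]; ⊤⁺)
open import Relation.Unary using (Pred; U; _∈_; _⊆_; _∪_; ｛_｝)

private variable
  α β γ : Modality
  A B C D : Formula
  S : Signature

-- Order and minimum on modalities.

<ᵐ-trans : α <ᵐ β → β <ᵐ γ → α <ᵐ γ
<ᵐ-trans = <⁺-trans ℕ.<-trans

<ᵐ-≤ᵐ-trans : α <ᵐ β → β ≤ᵐ γ → α <ᵐ γ
<ᵐ-≤ᵐ-trans Strict.[ p ] NonStrict.[ q ] = Strict.[ ℕ.<-≤-trans p q ]
<ᵐ-≤ᵐ-trans Strict.[ p ] (_ ≤⊤⁺)         = [ _ ]<⊤⁺
<ᵐ-≤ᵐ-trans [ _ ]<⊤⁺     (_ ≤⊤⁺)         = [ _ ]<⊤⁺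

≤ᵐ⇒<ᵐ∨≡ : α ≤ᵐ β → α <ᵐ β ⊎ α ≡ β
≤ᵐ⇒<ᵐ∨≡ NonStrict.[ p ] with ℕ.m≤n⇒m<n∨m≡n p
... | inj₁ q = inj₁ Strict.[ q ]
... | inj₂ e = inj₂ (cong [_] e)
≤ᵐ⇒<ᵐ∨≡ ([ _ ] ≤⊤⁺) = inj₁ [ _ ]<⊤⁺
≤ᵐ⇒<ᵐ∨≡ (⊤⁺ ≤⊤⁺)    = inj₂ refl

<ᵐ⇒≤ᵐ : α <ᵐ β → α ≤ᵐ β
<ᵐ⇒≤ᵐ Strict.[ p ] = NonStrict.[ ℕ.<⇒≤ p ]
<ᵐ⇒≤ᵐ [ _ ]<⊤⁺     = _ ≤⊤⁺

≤ᵐ-refl : α ≤ᵐ α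
≤ᵐ-refl {[ _ ]} = NonStrict.[ ℕ.≤-refl ]
≤ᵐ-refl {⊤⁺}    = ⊤⁺ ≤⊤⁺

⊓-≤ˡ : ∀ α β → α ⊓ β ≤ᵐ α
⊓-≤ˡ [ m ] [ n ] = NonStrict.[ ℕ.m⊓n≤m m n ]
⊓-≤ˡ [ _ ] ⊤⁺    = ≤ᵐ-refl
⊓-≤ˡ ⊤⁺    β     = β ≤⊤⁺

⊓-≤ʳ : ∀ α β → α ⊓ β ≤ᵐ β
⊓-≤ʳ [ m ] [ n ] = NonStrict.[ ℕ.m⊓n≤n m n ]
⊓-≤ʳ [ m ] ⊤⁺    = [ m ] ≤⊤⁺
⊓-≤ʳ ⊤⁺    _     = ≤ᵐ-refl

β≤α⇒α⊓β≡β : β ≤ᵐ α → α ⊓ β ≡ β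
β≤α⇒α⊓β≡β NonStrict.[ p ] = cong [_] (ℕ.m≥n⇒m⊓n≡n p)
β≤α⇒α⊓β≡β (_ ≤⊤⁺)         = refl

β≤α⇒β⊓α≡β : β ≤ᵐ α → β ⊓ α ≡ β
β≤α⇒β⊓α≡β NonStrict.[ p ] = cong [_] (ℕ.m≤n⇒m⊓n≡m p)
β≤α⇒β⊓α≡β ([ _ ] ≤⊤⁺)     = refl
β≤α⇒β⊓α≡β (⊤⁺ ≤⊤⁺)        = refl

-- Soundness

-- Frame composition lands at `α ⊓ β`, equal to the smaller modality only propositionally.
-- Irrelevance of the membership proofs lets `refl` finish.
R-cong : ∀ {W : Set} (R : Relations S W) .(a : α ∈ S) .(b : β ∈ S) {x y} →
         α ≡ β → R α a x y → R β b x y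
R-cong R a b refl r = r

module RJFrameProperties {W : Set} {R : Relations S W} (F : IsRJFrame R) where
  open IsRJFrame F renaming (comp to R-comp)

  compˡ : ∀ {x y z} (a : α ∈ S) (b : β ∈ S) → β ≤ᵐ α → R α a x y → R β b y z → R β b x z
  compˡ a b β≤α r q = R-cong R (⊓-closed S a b) b (β≤α⇒α⊓β≡β β≤α) (R-comp a b r q)

  compʳ : ∀ {x y z} (a : α ∈ S) (b : β ∈ S) → β ≤ᵐ α → R β b x y → R α a y z → R β b x z
  compʳ a b β≤α r q = R-cong R (⊓-closed S b a) b (β≤α⇒β⊓α≡β β≤α) (R-comp b a r q)

  R-trans : ∀ {x y z} (a : α ∈ S) → R α a x y → R α a y z → R α a x z
  R-trans a = compˡ a a ≤ᵐ-refl

infix 4 _⊨_⇒_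

_⊨_⇒_ : Model S → Formula → Formula → Set
M ⊨ A ⇒ B = ∀ {x} → M , x ⊩ A → M , x ⊩ B

-- Any signature will do: each modality in the conclusion of a built-in axiom already occurs in its
-- premise, whose forcing supplies the membership in `S`.
RJ+-sound : ∀ {X} (M : Model S) → IsRJFrame (Model.R M) →
            (∀ {A B} → X A B → M ⊨ A ⇒ B) → RJ+ X A B → M ⊨ A ⇒ B
RJ+-sound {X = X} M F X-sound = go
  where
  open IsRJFrame F renaming (eucl to R-eucl)
  open RJFrameProperties F

  go : RJ+ X A B → M ⊨ A ⇒ B
  go (axiom p)     f                             = X-sound p f
  go identity      f                             = f
  go top           f                             = tt
  go (cut p q)     f                             = go q (go p f)
  go ∧-elimˡ       f                             = proj₁ f
  go ∧-elimʳ       f                             = proj₂ f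
  go (∧-intro p q) f                             = go p f , go q f
  go (nec p)       (a , y , r , f)               = a , y , r , go p f
  go trans         (a , y , r , b , z , q , f)   = a , z , R-trans a r q , f
  go (absorbˡ β≤α) (a , y , r , b , z , q , f)   = b , z , compˡ a b β≤α r q , f
  go (absorbʳ β≤α) (b , y , r , a , z , q , f)   = b , z , compʳ a b β≤α r q , f
  go (import∧ β<α) ((a , y , r , f) , b , z , q , g) =
    a , y , r , f , b , z , R-eucl a b β<α r q , g

-- `lower` introduces a new modality `β`; over the signature `U` its membership is automatic.
RC-sound-total : (M : Model U) → IsRCFrame (Model.R M) → A ⊢RC B → M ⊨ A ⇒ B
RC-sound-total M F = RJ+-sound M isRJFrame
  λ { (lower β<α) (_ , y , r , f) → _ , y , R-mono _ _ β<α r , f }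
  where open IsRCFrame F renaming (mono to R-mono)

-- For β ∉ S this is the largest choice of R_β compatible with the relations
-- R_γ, γ ∈ S, γ < β.
module TotalExpansion {W : Set} {R : Relations S W} (F : IsRCFrame R) where
  open IsRCFrame F renaming (eucl to R-eucl; mono to R-mono)
  open RJFrameProperties isRJFrame

  record R⁺ (β : Modality) (x y : W) : Set where
    constructor expanded
    field
      below : ∀ {γ} (c : γ ∈ S) → γ <ᵐ β → R γ c x y
      -- The Euclidean condition between `β` and a smaller `γ ∈ S`, imposed outright because `β` may
      -- lie outside `S`.
      pass  : ∀ {γ z} (c : γ ∈ S) → γ <ᵐ β → R γ c x z → R γ c y z
      at    : (b : β ∈ S) → R β b x y
  open R⁺

  R⊆R⁺ : ∀ {x y} (a : α ∈ S) → R α a x y → R⁺ α x y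
  R⊆R⁺ a r = expanded (λ c γ<α → R-mono a c γ<α r) (λ c γ<α → R-eucl a c γ<α r) (λ _ → r)

  R⁺-mono : ∀ {x y} → β <ᵐ α → R⁺ α x y → R⁺ β x y
  R⁺-mono β<α r = expanded
    (λ c γ<β → below r c (<ᵐ-trans γ<β β<α))
    (λ c γ<β → pass r c (<ᵐ-trans γ<β β<α))
    (λ b → below r b β<α)

  R⁺-antitone : ∀ {x y} → β ≤ᵐ α → R⁺ α x y → R⁺ β x y
  R⁺-antitone β≤α r with ≤ᵐ⇒<ᵐ∨≡ β≤α
  ... | inj₁ β<α  = R⁺-mono β<α r
  ... | inj₂ refl = r

  R⁺-trans : ∀ {x y z} → R⁺ α x y → R⁺ α y z → R⁺ α x z
  R⁺-trans r q = expanded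
    (λ c γ<α → R-trans c (below r c γ<α) (below q c γ<α))
    (λ c γ<α → pass q c γ<α ∘ pass r c γ<α)
    (λ a → R-trans a (at r a) (at q a))

  R⁺-eucl : ∀ {x y z} → β <ᵐ α → R⁺ α x y → R⁺ β x z → R⁺ β y z
  R⁺-eucl β<α r q = expanded
    (λ c γ<β → pass r c (<ᵐ-trans γ<β β<α) (below q c γ<β))
    -- An arrow out of `y` is pulled back to `x` by transitivity and then passed on to `z`.
    (λ c γ<β s → pass q c γ<β (R-trans c (below r c (<ᵐ-trans γ<β β<α)) s))
    (λ b → pass r b β<α (at q b))

  R⁺-isRCFrame : IsRCFrame {U} (λ β _ → R⁺ β)
  R⁺-isRCFrame = record
    { isRJFrame = record
      -- Monotonicity lowers both arrows to `α ⊓ β`, so composition reduces to transitivity.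
      { comp = λ {α} {β} _ _ r q →
          R⁺-trans (R⁺-antitone (⊓-≤ˡ α β) r) (R⁺-antitone (⊓-≤ʳ α β) q)
      ; eucl = λ _ _ → R⁺-eucl
      }
    ; mono = λ _ _ → R⁺-mono
    }

module _ (M : Model S) (F : IsRCFrame (Model.R M)) where
  open TotalExpansion F

  expand : Model U
  expand = record { W = Model.W M ; R = λ β _ → R⁺ β ; V = Model.V M }

  ⊩⇒expand-⊩ : ∀ A {x} → M , x ⊩ A → expand , x ⊩ A
  ⊩⇒expand-⊩ (var p)   f               = f
  ⊩⇒expand-⊩ ⊤ᶠ        f               = f
  ⊩⇒expand-⊩ (A ∧ᶠ B)  (f , g)         = ⊩⇒expand-⊩ A f , ⊩⇒expand-⊩ B g
  ⊩⇒expand-⊩ (⟨ α ⟩ A) (a , y , r , f) = tt , y , R⊆R⁺ a r , ⊩⇒expand-⊩ A f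

  -- `R⁺` may be nonempty outside `S`, so the modalities of the formula must lie in `S`; there `at`
  -- recovers the original relation.
  expand-⊩⇒⊩ : ∀ A → modalities A ⊆ S → ∀ {x} → expand , x ⊩ A → M , x ⊩ A
  expand-⊩⇒⊩ (var p)   A⊆S f               = f
  expand-⊩⇒⊩ ⊤ᶠ        A⊆S f               = f
  expand-⊩⇒⊩ (A ∧ᶠ B)  A⊆S (f , g)         =
    expand-⊩⇒⊩ A (λ a → A⊆S (inj₁ a)) f , expand-⊩⇒⊩ B (λ b → A⊆S (inj₂ b)) g
  expand-⊩⇒⊩ (⟨ α ⟩ A) A⊆S (_ , y , r , f) =
    A⊆S (inj₁ refl) , y , R⁺.at r (A⊆S (inj₁ refl)) ,
    expand-⊩⇒⊩ A (λ a → A⊆S (inj₂ a)) f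

  RC-sound : modalities B ⊆ S → A ⊢RC B → M ⊨ A ⇒ B
  RC-sound {B} {A} B⊆S p f =
    expand-⊩⇒⊩ B B⊆S (RC-sound-total expand R⁺-isRCFrame p (⊩⇒expand-⊩ A f))

-- Homomorphic images of the canonical tree.

Valuation-left : ∀ A B {p} x → Valuation A p x → Valuation (A ∧ᶠ B) p (map inj₁ x)
Valuation-left A B nothing  v = inj₁ v
Valuation-left A B (just x) v = v

Valuation-right : ∀ A B {p} x → Valuation B p x → Valuation (A ∧ᶠ B) p (map inj₂ x)
Valuation-right A B nothing  v = inj₂ v
Valuation-right A B (just x) v = v

module _ (M : Model S) where
  open Model M

  -- An arbitrary `h` is needed for the induction, which composes it with the embeddings of the
  -- subtrees.
  hom-image-⊩ : ∀ A → modalities A ⊆ S → (h : Node A → W) →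
                (∀ {α x y} (a : α ∈ S) → Edge A α x y → R α a (h x) (h y)) →
                (∀ {p} x → Valuation A p x → V p (h x)) →
                M , h (root A) ⊩ A
  hom-image-⊩ (var p)   A⊆S h hR hV = hV nothing refl
  hom-image-⊩ ⊤ᶠ        A⊆S h hR hV = tt
  hom-image-⊩ (A ∧ᶠ B)  A⊆S h hR hV =
    hom-image-⊩ A (λ a → A⊆S (inj₁ a)) (h ∘ map inj₁)
      (λ a → hR a ∘ left) (λ x → hV (map inj₁ x) ∘ Valuation-left A B x) ,
    hom-image-⊩ B (λ b → A⊆S (inj₂ b)) (h ∘ map inj₂)
      (λ a → hR a ∘ right) (λ x → hV (map inj₂ x) ∘ Valuation-right A B x)
  hom-image-⊩ (⟨ α ⟩ A) A⊆S h hR hV =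
    A⊆S (inj₁ refl) , h (just (root A)) , hR (A⊆S (inj₁ refl)) new ,
    hom-image-⊩ A (λ a → A⊆S (inj₂ a)) (h ∘ just) (λ a → hR a ∘ old) (hV ∘ just)

modalities⊆ℓ : ∀ A {X : Pred Formula 0ℓ} → A ∈ X → modalities A ⊆ ℓ X
modalities⊆ℓ A A∈X α∈A = A , A∈X , α∈A

Edge-support : ∀ {x y} → Edge A α x y → α ∈ modalities A
Edge-support (left e)  = inj₁ (Edge-support e)
Edge-support (right e) = inj₂ (Edge-support e)
Edge-support new       = inj₁ refl
Edge-support (old e)   = inj₂ (Edge-support e)

RJ-root⊩ : ∀ A (A⊆S : ℓ ｛ A ｝ ⊆ S) → RJ⟦ S , A , A⊆S ⟧ , root A ⊩ A
RJ-root⊩ {S} A A⊆S =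
  hom-image-⊩ RJ⟦ S , A , A⊆S ⟧ A (λ a → A⊆S (modalities⊆ℓ A refl a)) id
    (λ a e → base a (modalities⊆ℓ A refl (Edge-support e) , e)) (λ _ → id)

RC-root⊩ : ∀ A (A⊆S : ℓ ｛ A ｝ ⊆ S) → RC⟦ S , A , A⊆S ⟧ , root A ⊩ A
RC-root⊩ {S} A A⊆S =
  hom-image-⊩ RC⟦ S , A , A⊆S ⟧ A (λ a → A⊆S (modalities⊆ℓ A refl a)) id
    (λ a e → base a (modalities⊆ℓ A refl (Edge-support e) , e)) (λ _ → id)

-- Completeness

module Canonical (X : Rel Formula 0ℓ) where

  infix 4 _⊢_
  _⊢_ : Rel Formula 0ℓ
  _⊢_ = RJ+ X

  ∧-monoˡ : A ⊢ B → A ∧ᶠ C ⊢ B ∧ᶠ C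
  ∧-monoˡ p = ∧-intro (cut ∧-elimˡ p) ∧-elimʳ

  ∧-monoʳ : A ⊢ B → C ∧ᶠ A ⊢ C ∧ᶠ B
  ∧-monoʳ p = ∧-intro ∧-elimˡ (cut ∧-elimʳ p)

  record Filter : Set₁ where
    field
      Mem    : Pred Formula 0ℓ
      has-⊤  : Mem ⊤ᶠ
      has-∧  : Mem A → Mem B → Mem (A ∧ᶠ B)
      upward : A ⊢ B → Mem A → Mem B
  open Filter

  theory : Formula → Filter
  theory A = record
    { Mem    = A ⊢_
    ; has-⊤  = top
    ; has-∧  = ∧-intro
    ; upward = λ p q → cut q p
    }

  -- `diamond` is the usual canonical relation; `persist` builds in the counterpart of `import∧`,
  -- which yields the Euclidean condition.
  record Rᶜ (α : Modality) (F G : Filter) : Set where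
    constructor related
    field
      diamond : Mem G D → Mem F (⟨ α ⟩ D)
      persist : β <ᵐ α → Mem F (⟨ β ⟩ D) → Mem G (⟨ β ⟩ D)
  open Rᶜ

  Rᶜ-comp : ∀ {F G H} → Rᶜ α F G → Rᶜ β G H → Rᶜ (α ⊓ β) F H
  Rᶜ-comp {α} {β} {F} r q = related
    (λ d → upward F collapse (diamond r (diamond q d)))
    (λ γ< → persist q (<ᵐ-≤ᵐ-trans γ< (⊓-≤ʳ α β)) ∘ persist r (<ᵐ-≤ᵐ-trans γ< (⊓-≤ˡ α β)))
    where
    collapse : ⟨ α ⟩ ⟨ β ⟩ D ⊢ ⟨ α ⊓ β ⟩ D
    -- Abstracting `α ⊓ β` makes the equation matchable; the bound by the other modality becomes the
    -- side condition of absorption.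
    collapse with α ⊓ β | ⊓-sel α β | ⊓-≤ˡ α β | ⊓-≤ʳ α β
    ... | _ | inj₁ refl | _   | α≤β = absorbʳ α≤β
    ... | _ | inj₂ refl | β≤α | _   = absorbˡ β≤α

  Rᶜ-eucl : ∀ {F G H} → β <ᵐ α → Rᶜ α F G → Rᶜ β F H → Rᶜ β G H
  Rᶜ-eucl {F = F} β<α r q = related
    (persist r β<α ∘ diamond q)
    -- `⟨ γ ⟩ D` in `G` gives `⟨ α ⟩ ⟨ γ ⟩ D` in `F`, which absorbs to `⟨ γ ⟩ D` and persists to
    -- `H`.
    (λ γ<β d → persist q γ<β (upward F (absorbˡ (<ᵐ⇒≤ᵐ (<ᵐ-trans γ<β β<α))) (diamond r d)))

  -- Quantifying over C makes this closed under ∧ᶠ, which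
  -- { D : ⟨ α ⟩ (B ∧ᶠ D) ∈ F } need not be.
  successor : Modality → Formula → Filter → Filter
  successor α B F = record
    { Mem    = λ D → ∀ {C} → C ⊢ B → Mem F (⟨ α ⟩ C) → Mem F (⟨ α ⟩ (C ∧ᶠ D))
    ; has-⊤  = λ _ → upward F (nec (∧-intro identity top))
    -- `d` is used at `C`, then `e` at `C ∧ᶠ D`, which still derives `B`; what remains is
    -- rebracketing.
    ; has-∧  = λ d e p m → upward F
        (nec (∧-intro (cut ∧-elimˡ ∧-elimˡ) (∧-monoˡ ∧-elimʳ)))
        (e (cut ∧-elimˡ p) (d p m))
    ; upward = λ q d p m → upward F (nec (∧-monoʳ q)) (d p m)
    }

  successor-∋ : ∀ F → Mem (successor α B F) B
  successor-∋ F p = upward F (nec (∧-intro identity p))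

  -- Taking `C` to be `B` gives `diamond`; `import∧` at every `C` gives `persist`.
  successor-Rᶜ : ∀ F → Mem F (⟨ α ⟩ B) → Rᶜ α F (successor α B F)
  successor-Rᶜ F m = related
    (λ d → upward F (nec ∧-elimʳ) (d identity m))
    (λ β<α e _ c → upward F (import∧ β<α) (has-∧ F c e))

  filter : ∀ A → Filter → Node A → Filter
  filter A         F nothing         = F
  filter (A ∧ᶠ B)  F (just (inj₁ x)) = filter A F (just x)
  filter (A ∧ᶠ B)  F (just (inj₂ x)) = filter B F (just x)
  filter (⟨ α ⟩ A) F (just x)        = filter A (successor α A F) x

  filter-left : ∀ A B F x → filter (A ∧ᶠ B) F (map inj₁ x) ≡ filter A F x
  filter-left A B F nothing  = refl
  filter-left A B F (just x) = refl

  filter-right : ∀ A B F x → filter (A ∧ᶠ B) F (map inj₂ x) ≡ filter B F x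
  filter-right A B F nothing  = refl
  filter-right A B F (just x) = refl

  -- Membership of the formula in `F` is the invariant: conjuncts inherit it, and `successor-∋`
  -- restores it below a diamond.
  filter-edge : ∀ {x y} F → Mem F A → Edge A α x y → Rᶜ α (filter A F x) (filter A F y)
  filter-edge F m (left {A} {B} {x = x} {y} e) =
    subst₂ (Rᶜ _) (sym (filter-left A B F x)) (sym (filter-left A B F y))
      (filter-edge F (upward F ∧-elimˡ m) e)
  filter-edge F m (right {A} {B} {x = x} {y} e) =
    subst₂ (Rᶜ _) (sym (filter-right A B F x)) (sym (filter-right A B F y))
      (filter-edge F (upward F ∧-elimʳ m) e)
  filter-edge F m new     = successor-Rᶜ F m
  filter-edge F m (old e) = filter-edge (successor _ _ F) (successor-∋ F) e

  filter-valuation : ∀ A F x {p} → Mem F A → Valuation A p x → Mem (filter A F x) (var p)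
  filter-valuation (var p)   F nothing         m refl     = m
  filter-valuation (A ∧ᶠ B)  F nothing         m (inj₁ v) =
    filter-valuation A F nothing (upward F ∧-elimˡ m) v
  filter-valuation (A ∧ᶠ B)  F nothing         m (inj₂ v) =
    filter-valuation B F nothing (upward F ∧-elimʳ m) v
  filter-valuation (A ∧ᶠ B)  F (just (inj₁ x)) m v        =
    filter-valuation A F (just x) (upward F ∧-elimˡ m) v
  filter-valuation (A ∧ᶠ B)  F (just (inj₂ x)) m v        =
    filter-valuation B F (just x) (upward F ∧-elimʳ m) v
  filter-valuation (⟨ α ⟩ A) F (just x)        m v        =
    filter-valuation A (successor α A F) x (successor-∋ F) v

  module _ (M : Model S) (h : Model.W M → Filter) where
    open Model M

    -- One direction of a truth lemma suffices, so no successors have to be found: `diamond` carries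
    -- membership back along arrows.
    ⊩⇒∈ : (∀ {α x y} (a : α ∈ S) → R α a x y → Rᶜ α (h x) (h y)) →
          (∀ {p x} → V p x → Mem (h x) (var p)) →
          ∀ B {x} → M , x ⊩ B → Mem (h x) B
    ⊩⇒∈ hR hV (var p)   f               = hV f
    ⊩⇒∈ hR hV ⊤ᶠ        {x} f           = has-⊤ (h x)
    ⊩⇒∈ hR hV (B ∧ᶠ C)  {x} (f , g)     = has-∧ (h x) (⊩⇒∈ hR hV B f) (⊩⇒∈ hR hV C g)
    ⊩⇒∈ hR hV (⟨ α ⟩ B) (a , y , r , f) = diamond (hR a r) (⊩⇒∈ hR hV B f)

  module _ (A : Formula) where

    node-filter : Node A → Filter
    node-filter = filter A (theory A)

    Rᵀ : Relations S (Node A)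
    Rᵀ α _ x y = Rᶜ α (node-filter x) (node-filter y)

    Rᵀ-isRJFrame : IsRJFrame {S} Rᵀ
    Rᵀ-isRJFrame = record { comp = λ _ _ → Rᶜ-comp ; eucl = λ _ _ → Rᶜ-eucl }

    -- The root is sent to `theory A`, where membership of `B` is by definition `A ⊢ B`.
    complete : (Q : Relations S (Node A)) →
               (∀ {α x y} (a : α ∈ S) → Q α a x y → Rᵀ {S} α a x y) →
               record { W = Node A ; R = Q ; V = Valuation A } , root A ⊩ B → A ⊢ B
    complete {B = B} Q Q⊆Rᵀ = ⊩⇒∈ _ node-filter Q⊆Rᵀ
      (λ {_} {x} → filter-valuation A (theory A) x identity) B

-- Completeness of the two logics and the equivalences.

module RJ = Canonical Never
module RC = Canonical Monotonicity

RJ-complete : ∀ A B .(A⊆S : ℓ ｛ A ｝ ⊆ S) → RJ⟦ S , A , A⊆S ⟧ , root A ⊩ B → A ⊢RJ B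
RJ-complete A B A⊆S = RJ.complete A _
  (RJ-least _ (RJ.Rᵀ A) (λ _ (_ , e) → RJ.filter-edge (RJ.theory A) identity e)
    (RJ.Rᵀ-isRJFrame A))

RC-complete : ∀ A B .(A⊆S : ℓ ｛ A ｝ ⊆ S) → RC⟦ S , A , A⊆S ⟧ , root A ⊩ B → A ⊢RC B
RC-complete A B A⊆S = RC.complete A _
  (RC-least _ (RC.Rᵀ A) (λ _ (_ , e) → RC.filter-edge (RC.theory A) identity e)
    (record { isRJFrame = RC.Rᵀ-isRJFrame A ; mono = λ _ _ → Rᶜ-mono }))
  where
  open RC.Rᶜ
  Rᶜ-mono : ∀ {F G} → β <ᵐ α → RC.Rᶜ α F G → RC.Rᶜ β F G
  Rᶜ-mono {F = F} β<α r = RC.related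
    (λ d → RC.Filter.upward F (axiom (lower β<α)) (diamond r d))
    (λ γ<β → persist r (<ᵐ-trans γ<β β<α))

theorem5p2 : (A B : Formula) →
    (let S = ℓ ｛ A ｝ in
    (A ⊢RJ B) ⇔ (RJ⟦ S , A , (λ α∈ℓA → α∈ℓA) ⟧ , root A ⊩ B))
    ×
    (let S = ℓ (｛ A ｝ ∪ ｛ B ｝) in
    (A ⊢RC B) ⇔ (RC⟦ S , A , ℓ-mono ｛ A ｝ (｛ A ｝ ∪ ｛ B ｝) inj₁ ⟧ , root A ⊩ B))
theorem5p2 A B =
  mk⇔ (λ p → RJ+-sound RJ⟦ _ , A , id ⟧ (RJ-isRJFrame _) (λ ()) p (RJ-root⊩ A id))
      (RJ-complete A B id) ,
  mk⇔ (λ p → RC-sound RC⟦ _ , A , ⊆ₗ ⟧ (RC-isRCFrame _) (modalities⊆ℓ B (inj₂ refl)) p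
                      (RC-root⊩ A ⊆ₗ))
      (RC-complete A B ⊆ₗ)
  where
  ⊆ₗ : ℓ ｛ A ｝ ⊆ ℓ (｛ A ｝ ∪ ｛ B ｝)
  ⊆ₗ = ℓ-mono ｛ A ｝ (｛ A ｝ ∪ ｛ B ｝) inj₁
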